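{- Let $\sigma$ be a finite signature, $\psi$ a strictly limited e-complexity measure over $\sigma$, $C$ a nonempty class of structures of $\sigma$, and $H$ a nonempty subset of $H^{=}(\sigma)$. If the problem of solvability for the quadruple $(\mathrm{Probl}^{=}(\sigma),\mathrm{Tree}^{=}(\sigma),H,C)$ is decidable, then the problem of e-optimization for the triple $(\psi,H,C)$ is decidable.
   Context: Notation: $\omega=\{0,1,2,\dots\}$, $E_2=\{0,1\}$, variables $X=\{x_i:i\in\omega\}$, $X_n=\{x_0,\dots,x_{n-1}\}$; $\alpha^1=\alpha$, $\alpha^0=\neg\alpha$. The signature $\sigma=\{q_1,\dots,q_m\}$ (predicate and function symbols with arities); $\sigma_==\sigma\cup\{q_0\}$ where $q_0$ denotes equality; $\sigma_=^*$ is the set of finite words over $\sigma_=$ including the empty word $\lambda$. An e-complexity measure is $\psi:\sigma_=^*\to\omega$; it is strictly limited if computable and $\psi(\alpha_1\alpha_2\alpha_3)>\psi(\alpha_1\alpha_3)$ for all $\alpha_1,\alpha_2,\alpha_3\in\sigma_=^*$ with $\alpha_2\ne\lambda$. A function expression is $x_j\Leftarrow f(x_{l_1},\dots,x_{l_m})$; a predicate expression is $x_{l_1}=x_{l_2}$ or $r(x_{l_1},\dots,x_{l_k})$. For $n\ge1$ and a sequence $\beta=\beta_1,\dots,\beta_m$ define term sequences $M_i=(t_{i0},t_{i1},\dots)$: $M_1=(x_0,\dots,x_{n-1},x_{n-1},\dots)$; $M_{i+1}=M_i$ if $\beta_i$ is a predicate expression; if $\beta_i$ is $x_j\Leftarrow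 f(x_{l_1},\dots,x_{l_m})$, $M_{i+1}$ is $M_i$ with $t_{ij}$ replaced by $f(t_{il_1},\dots,t_{il_m})$. For predicate $\beta_i$, $\kappa(n,\beta,\beta_i)$ is $t_{il_1}=t_{il_2}$ or $r(t_{il_1},\dots,t_{il_k})$ respectively. $\mathrm{word}(\beta)=q_{i_1}\cdots q_{i_m}\in\sigma_=^*$ where $q_{i_j}$ is the symbol of $\sigma_=$ in $\beta_j$ ($q_0$ for $x_{l_1}=x_{l_2}$). $\mathrm{Tree}^{=}(\sigma)$: schemes $S=(n,G)$, $n\ge1$, $G$ a finite rooted directed tree with function nodes (function expression, one outgoing edge), predicate nodes (predicate expression, two outgoing edges labeled $0,1$), terminal nodes (labeled by numbers in $\omega$). For a complete path $\tau=w_1,d_1,\dots,w_m,d_m,w_{m+1}$ with expressions $\beta_\tau$, $F(\tau)$ is the set of $\kappa(n,\beta_\tau,\beta_i)^c$ for predicate nodes $w_i$, $c$ the label of $d_i$ (a tautology if none), $t_\tau$ the terminal label. For a structure $U$ with universe $A$, $\varphi_{(S,U)}(\bar a)=t_\tau$ for the unique complete path $\tau$ with all of $F(\tau)$ true in $U$ on $\bar a\in A^n$. $\psi(S)=\max_\tau\psi(\mathrm{word}(\beta_\tau))$ over complete paths. $\mathrm{Probl}^{=}(\sigma)$: schemes $s=(n,\nu,\beta_1,\dots,\beta_m)$, $n,m\ge1$, with exactly $k\ge1$ predicate expressions $\beta_{i_1},\dots,\beta_{i_k}$, $\nu:E_2^k\to\omega$; with $\alpha_j=\kappa(n,\beta,\beta_{i_j})$,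 $\varphi_{(s,U)}(\bar a)=\nu(\alpha_1(\bar a),\dots,\alpha_k(\bar a))$. $S=(n_1,G)$ solves $s=(n_2,\dots)$ relative to class $C$ if $n_1=n_2$ and either $C=\emptyset$ or $\varphi_{(S,U)}=\varphi_{(s,U)}$ for all $U\in C$. $H^{=}(\sigma)$: all sentences of $\sigma$; $C(\alpha)=\{U\in C:U\models\alpha\}$. Problem of solvability for $(\mathrm{Probl}^{=}(\sigma),\mathrm{Tree}^{=}(\sigma),H,C)$: given $\alpha\in H$, $s$, $S$, decide whether $S$ solves $s$ relative to $C(\alpha)$. Problem of e-optimization for $(\psi,H,C)$: given $\alpha\in H$ and $s\in\mathrm{Probl}^{=}(\sigma)$, find $S\in\mathrm{Tree}^{=}(\sigma)$ solving $s$ relative to $C(\alpha)$ with minimum $\psi(S)$ among such schemes. Decidable means solvable by an algorithm. -}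

module Defs where

open import Level using (Level; _⊔_) renaming (suc to lsuc)
open import Data.Nat.Base as ℕ using (ℕ; zero; suc; _≤_; _<_; _≡ᵇ_; s≤s; z≤n)
open import Data.Fin.Base using (Fin; zero; suc)
open import Data.Bool.Base using (Bool; true; false; if_then_else_)
open import Data.List.Base using (List; []; _∷_; _++_; map; foldr)
open import Data.List.Relation.Unary.All using (All)
open import Data.Vec.Base as Vec using (Vec; []; _∷_; lookup)
open import Data.Product.Base using (Σ; _×_; _,_; proj₁)
open import Data.Sum.Base using (_⊎_; inj₁; inj₂)
open import Relation.Nullary using (¬_; Dec)
open import Relation.Binary.PropositionalEquality using (_≡_; _≢_; subst; sym)

-- Finite signatures σ = {q₁,…,qₘ}.  Symbol qᵢ₊₁ is represented by i : Fin m.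

data Kind : Set where
  predK funK : Kind

record Signature : Set where
  field
    m     : ℕ
    kind  : Fin m → Kind
    arity : Fin m → ℕ
open Signature public

FunSym : Signature → Set
FunSym σ = Σ (Fin (m σ)) λ f → kind σ f ≡ funK

PredSym : Signature → Set
PredSym σ = Σ (Fin (m σ)) λ r → kind σ r ≡ predK

-- σ₌ = σ ∪ {q₀}: zero is q₀ (equality), suc i is q_{i+1}.
Sym= : Signature → Set
Sym= σ = Fin (suc (m σ))

Word : Signature → Set
Word σ = List (Sym= σ)

-- strictly limited e-complexity measure (computability is automatic:
-- ψ is an Agda function)
StrictlyLimited : ∀ {σ} → (Word σ → ℕ) → Set
StrictlyLimited ψ = ∀ α₁ α₂ α₃ → α₂ ≢ [] → ψ (α₁ ++ α₃) < ψ (α₁ ++ α₂ ++ α₃)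

record Structure (σ : Signature) (ℓ : Level) : Set (lsuc ℓ) where
  field
    Carrier    : Set ℓ
    inhabitant : Carrier
    funI       : (f : FunSym σ) → Vec Carrier (arity σ (proj₁ f)) → Carrier
    relI       : (r : PredSym σ) → Vec Carrier (arity σ (proj₁ r)) → Set ℓ
open Structure public

data Term (σ : Signature) (n : ℕ) : Set where
  var : Fin n → Term σ n
  app : (f : FunSym σ) → Vec (Term σ n) (arity σ (proj₁ f)) → Term σ n

data Atom (σ : Signature) (n : ℕ) : Set where
  _≐_ : Term σ n → Term σ n → Atom σ n
  rel : (r : PredSym σ) → Vec (Term σ n) (arity σ (proj₁ r)) → Atom σ n

data Formula (σ : Signature) : ℕ → Set where
  atom     : ∀ {n} → Atom σ n → Formula σ n
  ¬'_      : ∀ {n} → Formula σ n → Formula σ n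
  _∧'_     : ∀ {n} → Formula σ n → Formula σ n → Formula σ n
  _∨'_     : ∀ {n} → Formula σ n → Formula σ n → Formula σ n
  _⇒'_     : ∀ {n} → Formula σ n → Formula σ n → Formula σ n
  ∀'_      : ∀ {n} → Formula σ (suc n) → Formula σ n
  ∃'_      : ∀ {n} → Formula σ (suc n) → Formula σ n

Sentence : Signature → Set
Sentence σ = Formula σ 0

module _ {σ : Signature} {ℓ : Level} (U : Structure σ ℓ) where
  mutual
    eval : ∀ {n} → Vec (Carrier U) n → Term σ n → Carrier U
    eval ρ (var i)    = lookup ρ i
    eval ρ (app f ts) = funI U f (evalVec ρ ts)

    evalVec : ∀ {n k} → Vec (Carrier U) n → Vec (Term σ n) k → Vec (Carrier U) k
    evalVec ρ []       = []
    evalVec ρ (t ∷ ts) = eval ρ t ∷ evalVec ρ ts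

  HoldsAtom : ∀ {n} → Vec (Carrier U) n → Atom σ n → Set ℓ
  HoldsAtom ρ (t ≐ u)    = eval ρ t ≡ eval ρ u
  HoldsAtom ρ (rel r ts) = relI U r (evalVec ρ ts)

  -- α¹ = α, α⁰ = ¬α  (true ↦ 1, false ↦ 0)
  HoldsLit : ∀ {n} → Vec (Carrier U) n → Atom σ n → Bool → Set ℓ
  HoldsLit ρ a true  = HoldsAtom ρ a
  HoldsLit ρ a false = ¬ HoldsAtom ρ a

  Sat : ∀ {n} → Vec (Carrier U) n → Formula σ n → Set ℓ
  Sat ρ (atom a)  = HoldsAtom ρ a
  Sat ρ (¬' φ)    = ¬ Sat ρ φ
  Sat ρ (φ ∧' χ)  = Sat ρ φ × Sat ρ χ
  Sat ρ (φ ∨' χ)  = Sat ρ φ ⊎ Sat ρ χ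
  Sat ρ (φ ⇒' χ)  = Sat ρ φ → Sat ρ χ
  Sat ρ (∀' φ)    = (a : Carrier U) → Sat (a ∷ ρ) φ
  Sat ρ (∃' φ)    = Σ (Carrier U) λ a → Sat (a ∷ ρ) φ

_⊨_ : ∀ {σ ℓ} → Structure σ ℓ → Sentence σ → Set ℓ
U ⊨ α = Sat U [] α

record FunExpr (σ : Signature) : Set where
  constructor _⇐_⟨_⟩
  field
    target : ℕ
    fsym   : FunSym σ
    args   : Vec ℕ (arity σ (proj₁ fsym))

data PredExpr (σ : Signature) : Set where
  eqE  : ℕ → ℕ → PredExpr σ
  relE : (r : PredSym σ) → Vec ℕ (arity σ (proj₁ r)) → PredExpr σ

Expr : Signature → Set
Expr σ = FunExpr σ ⊎ PredExpr σ

symE : ∀ {σ} → Expr σ → Sym= σ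
symE (inj₁ (_ ⇐ f ⟨ _ ⟩)) = suc (proj₁ f)
symE (inj₂ (eqE _ _))     = zero
symE (inj₂ (relE r _))    = suc (proj₁ r)

word : ∀ {σ} → List (Expr σ) → Word σ
word = map symE

TermSeq : Signature → ℕ → Set
TermSeq σ n = ℕ → Term σ n

clamp : (k j : ℕ) → Fin (suc k)
clamp k       zero    = zero
clamp zero    (suc j) = zero
clamp (suc k) (suc j) = suc (clamp k j)

initSeq : ∀ {σ} (n : ℕ) → 1 ≤ n → TermSeq σ n
initSeq (suc k) _ j = var (clamp k j)

applyF : ∀ {σ n} → TermSeq σ n → FunExpr σ → TermSeq σ n
applyF M (j ⇐ f ⟨ ls ⟩) i = if i ≡ᵇ j then app f (Vec.map M ls) else M i

κ : ∀ {σ n} → TermSeq σ n → PredExpr σ → Atom σ n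
κ M (eqE l₁ l₂) = M l₁ ≐ M l₂
κ M (relE r ls) = rel r (Vec.map M ls)

data Tree (σ : Signature) : Set where
  leaf  : ℕ → Tree σ
  fnode : FunExpr σ → Tree σ → Tree σ
  pnode : PredExpr σ → (edge0 edge1 : Tree σ) → Tree σ

data Path {σ : Signature} : Tree σ → Set where
  end  : (t : ℕ) → Path (leaf t)
  viaF : ∀ {e G} → Path G → Path (fnode e G)
  via0 : ∀ {e G₀ G₁} → Path G₀ → Path (pnode e G₀ G₁)
  via1 : ∀ {e G₀ G₁} → Path G₁ → Path (pnode e G₀ G₁)

exprs : ∀ {σ} {G : Tree σ} → Path G → List (Expr σ)
exprs (end t)           = []
exprs (viaF {e = e} p)  = inj₁ e ∷ exprs p
exprs (via0 {e = e} p)  = inj₂ e ∷ exprs p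
exprs (via1 {e = e} p)  = inj₂ e ∷ exprs p

labelOf : ∀ {σ} {G : Tree σ} → Path G → ℕ
labelOf (end t)  = t
labelOf (viaF p) = labelOf p
labelOf (via0 p) = labelOf p
labelOf (via1 p) = labelOf p

conds : ∀ {σ n} {G : Tree σ} → TermSeq σ n → Path G → List (Atom σ n × Bool)
conds M (end t)          = []
conds M (viaF {e = e} p) = conds (applyF M e) p
conds M (via0 {e = e} p) = (κ M e , false) ∷ conds M p
conds M (via1 {e = e} p) = (κ M e , true) ∷ conds M p

allPaths : ∀ {σ} (G : Tree σ) → List (Path G)
allPaths (leaf t)        = end t ∷ []
allPaths (fnode e G)     = map viaF (allPaths G)
allPaths (pnode e G₀ G₁) = map via0 (allPaths G₀) ++ map via1 (allPaths G₁)

record TreeScheme (σ : Signature) : Set where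
  constructor treeScheme
  field
    n    : ℕ
    n≥1  : 1 ≤ n
    G    : Tree σ
open TreeScheme public

TreeOut : ∀ {σ ℓ} (S : TreeScheme σ) (U : Structure σ ℓ) →
          Vec (Carrier U) (n S) → ℕ → Set ℓ
TreeOut S U ā t =
  Σ (Path (G S)) λ τ →
    All (λ lc → HoldsLit U ā (proj₁ lc) (Data.Product.Base.proj₂ lc))
        (conds (initSeq (n S) (n≥1 S)) τ)
    × labelOf τ ≡ t

ψTree : ∀ {σ} → (Word σ → ℕ) → TreeScheme σ → ℕ
ψTree ψ S = foldr ℕ._⊔_ 0 (map (λ τ → ψ (word (exprs τ))) (allPaths (G S)))

npred : ∀ {σ} → List (Expr σ) → ℕ
npred []            = 0
npred (inj₁ _ ∷ βs) = npred βs
npred (inj₂ _ ∷ βs) = suc (npred βs)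

record ProblScheme (σ : Signature) : Set where
  field
    n    : ℕ
    n≥1  : 1 ≤ n
    β    : List (Expr σ)           -- β₁,…,βₘ (m ≥ 1 follows from k ≥ 1)
    k≥1  : 1 ≤ npred β
    ν    : Vec Bool (npred β) → ℕ
open ProblScheme

atomsOf : ∀ {σ n} → TermSeq σ n → (βs : List (Expr σ)) → Vec (Atom σ n) (npred βs)
atomsOf M []            = []
atomsOf M (inj₁ e ∷ βs) = atomsOf (applyF M e) βs
atomsOf M (inj₂ e ∷ βs) = κ M e ∷ atomsOf M βs

ProblOut : ∀ {σ ℓ} (s : ProblScheme σ) (U : Structure σ ℓ) →
           Vec (Carrier U) (n s) → ℕ → Set ℓ
ProblOut s U ā t =
  Σ (Vec Bool (npred (β s))) λ b →
    ((j : Fin (npred (β s))) →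
       HoldsLit U ā (lookup (atomsOf (initSeq (n s) (n≥1 s)) (β s)) j) (lookup b j))
    × ν s b ≡ t

Solves : ∀ {σ ℓ c} → TreeScheme σ → ProblScheme σ →
         (Structure σ ℓ → Set c) → Set (lsuc ℓ ⊔ c)
Solves {σ} S s C =
  Σ (TreeScheme.n S ≡ ProblScheme.n s) λ e →
    ∀ U → C U → (ā : Vec (Carrier U) (ProblScheme.n s)) (t : ℕ) →
      (TreeOut S U (subst (Vec (Carrier U)) (sym e) ā) t → ProblOut s U ā t)
      × (ProblOut s U ā t → TreeOut S U (subst (Vec (Carrier U)) (sym e) ā) t)

Restrict : ∀ {σ ℓ c} → (Structure σ ℓ → Set c) → Sentence σ → Structure σ ℓ → Set (ℓ ⊔ c)
Restrict C α U = C U × (U ⊨ α)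

SolvabilityDecidable : ∀ {σ ℓ c h} → (Sentence σ → Set h) → (Structure σ ℓ → Set c) →
                       Set (lsuc ℓ ⊔ c ⊔ h)
SolvabilityDecidable {σ} H C =
  (α : Sentence σ) → .(H α) → (s : ProblScheme σ) (S : TreeScheme σ) →
    Dec (Solves S s (Restrict C α))

EOptimizationDecidable : ∀ {σ ℓ c h} → (Word σ → ℕ) → (Sentence σ → Set h) →
                         (Structure σ ℓ → Set c) → Set (lsuc ℓ ⊔ c ⊔ h)
EOptimizationDecidable {σ} ψ H C =
  (α : Sentence σ) → .(H α) → (s : ProblScheme σ) →
    Σ (TreeScheme σ) λ S →
      Solves S s (Restrict C α)
      × ((S′ : TreeScheme σ) → Solves S′ s (Restrict C α) → ψTree ψ S ≤ ψTree ψ S′)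

{-# OPTIONS --safe #-}
-- Unfolding a problem s into the complete decision tree over its predicate
-- expressions gives a scheme S₀ solving s over any class.  Since ψ is strictly
-- limited, ψ(w) ≥ |w|, so every scheme S with ψ(S) ≤ D = ψ(S₀) has depth at
-- most D.  Moving every assignment to a fresh variable and clipping terminal
-- labels at max ν turns any solution into an equivalent one with the same
-- complexity, drawn from a finite, searchable set of trees (depth ≤ D,
-- variables < D + n, labels ≤ max ν).  Searching that set with the
-- solvability oracle for a solution of least complexity yields an optimum.
module Submission where

open import Defs
open import Level using (Level; Setω) renaming (suc to lsuc; _⊔_ to _⊔ℓ_)
open import Data.Nat.Base using (ℕ)
open import Data.Product.Base using (Σ)

open import Data.Nat.Base using (zero; suc; pred; _+_; _⊔_; _⊓_; _≤_; _<_; _≡ᵇ_; z≤n; s≤s)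
open import Data.Nat.Properties
  using (_≤?_; ≤-refl; ≤-pred; ≤-reflexive; ≤-trans; <-≤-trans; ≤-<-trans; ≤-total; ≮⇒≥; ≤-irrelevant;
         m<n⇒m<1+n; +-suc; +-monoˡ-≤; +-monoˡ-<; +-monoʳ-≤; n≤1+n; m+n≤o⇒m≤o;
         m≤m⊔n; m≤n⊔m; ⊔-lub; m⊔n≤o⇒m≤o; m⊔n≤o⇒n≤o; m⊓n≤n; m≤n⇒m⊓n≡m; module ≤-Reasoning)
open import Data.Fin.Base as Fin using (Fin; toℕ; fromℕ<)
open import Data.Fin.Properties using (any?; toℕ<n; toℕ-fromℕ<)
open import Data.Bool.Base using (Bool; true; false; if_then_else_)
open import Data.Empty using (⊥)
open import Data.List.Base using (List; []; _∷_; _++_; map; foldr; length)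
open import Data.List.Properties using (map-∘; map-cong; map-++; length-map)
open import Data.List.Membership.Propositional using (_∈_)
open import Data.List.Membership.Propositional.Properties using (∈-map⁺; ∈-++⁺ˡ; ∈-++⁺ʳ)
open import Data.List.Relation.Unary.Any using (here; there)
open import Data.List.Relation.Unary.All using (All; []; _∷_)
open import Data.Vec.Base as Vec using (Vec; []; _∷_; lookup)
import Data.Vec.Properties as Vec
open import Data.Product.Base using (∃; _×_; _,_; proj₁; proj₂)
open import Data.Sum.Base using (_⊎_; inj₁; inj₂; [_,_]′)
open import Function.Base using (_∘_)
open import Relation.Binary.Definitions using (DecidableEquality)
open import Relation.Binary.PropositionalEquality using (_≡_; refl; sym; trans; cong; cong₂; subst; module ≡-Reasoning)
open import Relation.Nullary.Decidable using (Dec; yes; no; map′; _×-dec_; _⊎-dec_)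
open import Relation.Unary using (Decidable)
open import Axiom.UniquenessOfIdentityProofs using (module Decidable⇒UIP)

Searchable : ∀ {a} → Set a → Setω
Searchable A = ∀ {p} (P : A → Set p) → Decidable P → Dec (∃ P)

module _ {a b} {A : Set a} {B : Set b} where

  searchable-⊎ : Searchable A → Searchable B → Searchable (A ⊎ B)
  searchable-⊎ search-A search-B P P? =
    map′ [ (λ (x , px) → inj₁ x , px) , (λ (y , py) → inj₂ y , py) ]′ split
         (search-A (P ∘ inj₁) (P? ∘ inj₁) ⊎-dec search-B (P ∘ inj₂) (P? ∘ inj₂))
    where
    split : ∃ P → ∃ (P ∘ inj₁) ⊎ ∃ (P ∘ inj₂)
    split (inj₁ x , px) = inj₁ (x , px)
    split (inj₂ y , py) = inj₂ (y , py)

searchable-Σ : ∀ {a b} {A : Set a} {B : A → Set b} →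
               Searchable A → (∀ x → Searchable (B x)) → Searchable (Σ A B)
searchable-Σ search-A search-B P P? =
  map′ (λ (x , y , p) → (x , y) , p) (λ ((x , y) , p) → x , y , p)
       (search-A (λ x → ∃ λ y → P (x , y)) (λ x → search-B x (λ y → P (x , y)) (λ y → P? (x , y))))

searchable-× : ∀ {a b} {A : Set a} {B : Set b} → Searchable A → Searchable B → Searchable (A × B)
searchable-× search-A search-B = searchable-Σ search-A (λ _ → search-B)

searchable-Vec : ∀ {a} {A : Set a} → Searchable A → ∀ k → Searchable (Vec A k)
searchable-Vec search-A zero P P? = map′ ([] ,_) (λ { ([] , p) → p }) (P? [])
searchable-Vec search-A (suc k) P P? =
  map′ (λ (x , xs , p) → x ∷ xs , p) (λ { (x ∷ xs , p) → x , xs , p })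
       (search-A (λ x → ∃ λ xs → P (x ∷ xs))
                 (λ x → searchable-Vec search-A k (λ xs → P (x ∷ xs)) (λ xs → P? (x ∷ xs))))

searchable-Fin : ∀ k → Searchable (Fin k)
searchable-Fin k P P? = any? P?

searchable-⊥ : Searchable ⊥
searchable-⊥ P P? = no λ ()

-- Equality proofs are unique here, so searching them is deciding x ≡ y.
searchable-≡ : ∀ {a} {A : Set a} → DecidableEquality A → (x y : A) → Searchable (x ≡ y)
searchable-≡ _≟_ x y P P? with x ≟ y
... | no x≢y = no λ (x≡y , _) → x≢y x≡y
... | yes x≡y = map′ (x≡y ,_) (λ (e , p) → subst P (Decidable⇒UIP.≡-irrelevant _≟_ e x≡y) p) (P? x≡y)

module _ {a p} {A : Set a} {P : A → Set p} (search : Searchable A) (P? : Decidable P) (f : A → ℕ) where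

  argmin-below : ∀ v → (∃ λ x → P x × f x ≤ v) → Σ A λ x → P x × (∀ y → P y → f x ≤ f y)
  argmin-below zero (x , px , fx≤0) = x , px , λ _ _ → ≤-trans fx≤0 z≤n
  argmin-below (suc v) (x , px , fx≤1+v) with search (λ y → P y × f y ≤ v) (λ y → P? y ×-dec f y ≤? v)
  ... | yes below = argmin-below v below
  ... | no ¬below = x , px , λ y py → ≮⇒≥ λ fy<fx → ¬below (y , py , ≤-pred (≤-trans fy<fx fx≤1+v))

  argmin : ∃ P → Σ A λ x → P x × (∀ y → P y → f x ≤ f y)
  argmin (x , px) = argmin-below (f x) (x , px , ≤-refl)

≤-foldr-⊔ : ∀ {x xs} → x ∈ xs → x ≤ foldr _⊔_ 0 xs
≤-foldr-⊔ {xs = y ∷ _} (here refl) = m≤m⊔n y _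
≤-foldr-⊔ {xs = y ∷ _} (there x∈) = ≤-trans (≤-foldr-⊔ x∈) (m≤n⊔m y _)

depth : ∀ {σ} → Tree σ → ℕ
depth (leaf _)        = 0
depth (fnode _ G)     = suc (depth G)
depth (pnode _ G₀ G₁) = suc (depth G₀ ⊔ depth G₁)

module _ {σ : Signature} where

  deepestPath : (G : Tree σ) → Σ (Path G) λ τ → depth G ≤ length (exprs τ)
  deepestPath (leaf t) = end t , z≤n
  deepestPath (fnode e G) = let τ , d≤ = deepestPath G in viaF τ , s≤s d≤
  deepestPath (pnode e G₀ G₁) with deepestPath G₀ | deepestPath G₁ | ≤-total (depth G₀) (depth G₁)
  ... | _ , _ | τ₁ , d₁≤ | inj₁ d₀≤d₁ = via1 τ₁ , s≤s (⊔-lub (≤-trans d₀≤d₁ d₁≤) d₁≤)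
  ... | τ₀ , d₀≤ | _ , _ | inj₂ d₁≤d₀ = via0 τ₀ , s≤s (⊔-lub d₀≤ (≤-trans d₁≤d₀ d₀≤))

  ∈-allPaths : {G : Tree σ} (τ : Path G) → τ ∈ allPaths G
  ∈-allPaths (end t)  = here refl
  ∈-allPaths (viaF τ) = ∈-map⁺ viaF (∈-allPaths τ)
  ∈-allPaths (via0 τ) = ∈-++⁺ˡ (∈-map⁺ via0 (∈-allPaths τ))
  ∈-allPaths {pnode _ G₀ _} (via1 τ) = ∈-++⁺ʳ (map via0 (allPaths G₀)) (∈-map⁺ via1 (∈-allPaths τ))

  ψ-path≤ψTree : ∀ ψ (S : TreeScheme σ) (τ : Path (G S)) → ψ (word (exprs τ)) ≤ ψTree ψ S
  ψ-path≤ψTree ψ S τ = ≤-foldr-⊔ (∈-map⁺ (λ τ → ψ (word (exprs τ))) (∈-allPaths τ))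

  module _ (ψ : Word σ → ℕ) (strict : StrictlyLimited {σ} ψ) where

    length≤ψ : ∀ w → length w ≤ ψ w
    length≤ψ []      = z≤n
    length≤ψ (x ∷ w) = ≤-<-trans (length≤ψ w) (strict [] (x ∷ []) w λ ())

    depth≤ψTree : ∀ S → depth (G S) ≤ ψTree ψ S
    depth≤ψTree S = let τ , d≤ = deepestPath (G S) in begin
      depth (G S)                ≤⟨ d≤ ⟩
      length (exprs τ)           ≡⟨ length-map symE (exprs τ) ⟨
      length (word (exprs τ))    ≤⟨ length≤ψ (word (exprs τ)) ⟩
      ψ (word (exprs τ))         ≤⟨ ψ-path≤ψTree ψ S τ ⟩
      ψTree ψ S                  ∎
      where open ≤-Reasoning

≡ᵇ-refl : ∀ m → (m ≡ᵇ m) ≡ true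
≡ᵇ-refl zero    = refl
≡ᵇ-refl (suc m) = ≡ᵇ-refl m

<⇒≡ᵇ-false : ∀ {m m′} → m < m′ → (m ≡ᵇ m′) ≡ false
<⇒≡ᵇ-false {zero}  (s≤s _)    = refl
<⇒≡ᵇ-false {suc m} (s≤s m<m′) = <⇒≡ᵇ-false m<m′

LitHolds : ∀ {σ ℓ n} (U : Structure σ ℓ) → Vec (Carrier U) n → Atom σ n × Bool → Set ℓ
LitHolds U ā (a , c) = HoldsLit U ā a c

-- A function node that is the k-th on its branch writes to the fresh variable
-- k + n, and ρ records where each original variable now lives.
module Normalise {σ : Signature} (n L : ℕ) where

  Renaming : Set
  Renaming = ℕ → ℕ

  _[_↦_] : Renaming → ℕ → ℕ → Renaming
  (ρ [ j ↦ v ]) i = if i ≡ᵇ j then v else ρ i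

  Fresh : Renaming → ℕ → Set
  Fresh ρ k = ∀ i → ρ i < k + n

  Tracks : Renaming → TermSeq σ n → TermSeq σ n → Set
  Tracks ρ M M′ = ∀ i → M′ (ρ i) ≡ M i

  renameP : Renaming → PredExpr σ → PredExpr σ
  renameP ρ (eqE l₁ l₂) = eqE (ρ l₁) (ρ l₂)
  renameP ρ (relE r ls) = relE r (Vec.map ρ ls)

  normalise : Renaming → ℕ → Tree σ → Tree σ
  normalise ρ k (leaf t)                   = leaf (t ⊓ L)
  normalise ρ k (fnode (j ⇐ f ⟨ ls ⟩) G)   =
    fnode ((k + n) ⇐ f ⟨ Vec.map ρ ls ⟩) (normalise (ρ [ j ↦ k + n ]) (suc k) G)
  normalise ρ k (pnode e G₀ G₁)            = pnode (renameP ρ e) (normalise ρ k G₀) (normalise ρ k G₁)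

  normalisePath : ∀ ρ k {G} → Path G → Path (normalise ρ k G)
  normalisePath ρ k (end t)                        = end (t ⊓ L)
  normalisePath ρ k (viaF {e = j ⇐ f ⟨ ls ⟩} τ)   = viaF (normalisePath (ρ [ j ↦ k + n ]) (suc k) τ)
  normalisePath ρ k (via0 τ)                       = via0 (normalisePath ρ k τ)
  normalisePath ρ k (via1 τ)                       = via1 (normalisePath ρ k τ)

  normalisePath-surjective : ∀ ρ k G (τ′ : Path (normalise ρ k G)) → ∃ λ τ → normalisePath ρ k τ ≡ τ′
  normalisePath-surjective ρ k (leaf t) (end _) = end t , refl
  normalisePath-surjective ρ k (fnode (j ⇐ f ⟨ ls ⟩) G) (viaF τ′) =
    let τ , eq = normalisePath-surjective (ρ [ j ↦ k + n ]) (suc k) G τ′ in viaF τ , cong viaF eq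
  normalisePath-surjective ρ k (pnode e G₀ G₁) (via0 τ′) =
    let τ , eq = normalisePath-surjective ρ k G₀ τ′ in via0 τ , cong via0 eq
  normalisePath-surjective ρ k (pnode e G₀ G₁) (via1 τ′) =
    let τ , eq = normalisePath-surjective ρ k G₁ τ′ in via1 τ , cong via1 eq

  labelOf-normalisePath : ∀ ρ k {G} (τ : Path G) → labelOf (normalisePath ρ k τ) ≡ labelOf τ ⊓ L
  labelOf-normalisePath ρ k (end t)                      = refl
  labelOf-normalisePath ρ k (viaF {e = j ⇐ f ⟨ ls ⟩} τ) = labelOf-normalisePath (ρ [ j ↦ k + n ]) (suc k) τ
  labelOf-normalisePath ρ k (via0 τ)                     = labelOf-normalisePath ρ k τ
  labelOf-normalisePath ρ k (via1 τ)                     = labelOf-normalisePath ρ k τ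

  symE-renameP : ∀ ρ e → symE {σ} (inj₂ (renameP ρ e)) ≡ symE (inj₂ e)
  symE-renameP ρ (eqE _ _)  = refl
  symE-renameP ρ (relE _ _) = refl

  word-normalisePath : ∀ ρ k {G} (τ : Path G) → word (exprs (normalisePath ρ k τ)) ≡ word (exprs τ)
  word-normalisePath ρ k (end t) = refl
  word-normalisePath ρ k (viaF {e = j ⇐ f ⟨ ls ⟩} τ) =
    cong (_ ∷_) (word-normalisePath (ρ [ j ↦ k + n ]) (suc k) τ)
  word-normalisePath ρ k (via0 {e = e} τ) = cong₂ _∷_ (symE-renameP ρ e) (word-normalisePath ρ k τ)
  word-normalisePath ρ k (via1 {e = e} τ) = cong₂ _∷_ (symE-renameP ρ e) (word-normalisePath ρ k τ)

  allPaths-normalise : ∀ ρ k G → allPaths (normalise ρ k G) ≡ map (normalisePath ρ k) (allPaths G)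
  allPaths-normalise ρ k (leaf t) = refl
  allPaths-normalise ρ k (fnode (j ⇐ f ⟨ ls ⟩) G) = begin
    map viaF (allPaths (normalise ρ′ (suc k) G))               ≡⟨ cong (map viaF) (allPaths-normalise ρ′ (suc k) G) ⟩
    map viaF (map (normalisePath ρ′ (suc k)) (allPaths G))    ≡⟨ map-∘ (allPaths G) ⟨
    map (viaF ∘ normalisePath ρ′ (suc k)) (allPaths G)        ≡⟨ map-∘ (allPaths G) ⟩
    map (normalisePath ρ k) (map viaF (allPaths G))           ∎
    where open ≡-Reasoning
          ρ′ = ρ [ j ↦ k + n ]
  allPaths-normalise ρ k (pnode e G₀ G₁) = begin
    map via0 (allPaths (normalise ρ k G₀)) ++ map via1 (allPaths (normalise ρ k G₁))
      ≡⟨ cong₂ (λ xs ys → map via0 xs ++ map via1 ys) (allPaths-normalise ρ k G₀) (allPaths-normalise ρ k G₁) ⟩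
    map via0 (map (normalisePath ρ k) (allPaths G₀)) ++ map via1 (map (normalisePath ρ k) (allPaths G₁))
      ≡⟨ cong₂ _++_ (sym (map-∘ (allPaths G₀))) (sym (map-∘ (allPaths G₁))) ⟩
    map (normalisePath ρ k ∘ via0) (allPaths G₀) ++ map (normalisePath ρ k ∘ via1) (allPaths G₁)
      ≡⟨ cong₂ _++_ (map-∘ (allPaths G₀)) (map-∘ (allPaths G₁)) ⟩
    map (normalisePath ρ k) (map via0 (allPaths G₀)) ++ map (normalisePath ρ k) (map via1 (allPaths G₁))
      ≡⟨ map-++ (normalisePath ρ k) (map via0 (allPaths G₀)) _ ⟨
    map (normalisePath ρ k) (map via0 (allPaths G₀) ++ map via1 (allPaths G₁)) ∎
    where open ≡-Reasoning

  ψTree-normalise : ∀ ψ ρ k p G → ψTree ψ (treeScheme n p (normalise ρ k G)) ≡ ψTree ψ (treeScheme n p G)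
  ψTree-normalise ψ ρ k p G = cong (foldr _⊔_ 0) (begin
    map cost (allPaths (normalise ρ k G))                ≡⟨ cong (map cost) (allPaths-normalise ρ k G) ⟩
    map cost (map (normalisePath ρ k) (allPaths G))      ≡⟨ map-∘ (allPaths G) ⟨
    map (cost ∘ normalisePath ρ k) (allPaths G)          ≡⟨ map-cong (cong ψ ∘ word-normalisePath ρ k) (allPaths G) ⟩
    map cost (allPaths G)                                ∎)
    where open ≡-Reasoning
          cost : ∀ {G} → Path G → ℕ
          cost τ = ψ (word (exprs τ))

  fresh-extend : ∀ {ρ k} → Fresh ρ k → ∀ j → Fresh (ρ [ j ↦ k + n ]) (suc k)
  fresh-extend fr j i with i ≡ᵇ j
  ... | true  = ≤-refl
  ... | false = m<n⇒m<1+n (fr i)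

  map-tracks : ∀ {ρ M M′ a} → Tracks ρ M M′ → (ls : Vec ℕ a) → Vec.map M′ (Vec.map ρ ls) ≡ Vec.map M ls
  map-tracks {ρ} {M} {M′} tr ls = trans (sym (Vec.map-∘ M′ ρ ls)) (Vec.map-cong tr ls)

  tracks-extend : ∀ {ρ k M M′} → Fresh ρ k → Tracks ρ M M′ → ∀ j f ls →
                  Tracks (ρ [ j ↦ k + n ]) (applyF M (j ⇐ f ⟨ ls ⟩)) (applyF M′ ((k + n) ⇐ f ⟨ Vec.map ρ ls ⟩))
  tracks-extend {k = k} fr tr j f ls i with i ≡ᵇ j
  ... | true  rewrite ≡ᵇ-refl (k + n) = cong (app f) (map-tracks tr ls)
  ... | false rewrite <⇒≡ᵇ-false (fr i) = tr i

  κ-renameP : ∀ {ρ M M′} → Tracks ρ M M′ → ∀ e → κ M′ (renameP ρ e) ≡ κ M e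
  κ-renameP tr (eqE l₁ l₂) = cong₂ _≐_ (tr l₁) (tr l₂)
  κ-renameP tr (relE r ls) = cong (rel r) (map-tracks tr ls)

  conds-normalisePath : ∀ {ρ k M M′ G} → Fresh ρ k → Tracks ρ M M′ → (τ : Path G) →
                        conds M′ (normalisePath ρ k τ) ≡ conds M τ
  conds-normalisePath fr tr (end t) = refl
  conds-normalisePath fr tr (viaF {e = j ⇐ f ⟨ ls ⟩} τ) =
    conds-normalisePath (fresh-extend fr j) (tracks-extend fr tr j f ls) τ
  conds-normalisePath fr tr (via0 {e = e} τ) = cong₂ (λ a → (a , false) ∷_) (κ-renameP tr e) (conds-normalisePath fr tr τ)
  conds-normalisePath fr tr (via1 {e = e} τ) = cong₂ (λ a → (a , true) ∷_) (κ-renameP tr e) (conds-normalisePath fr tr τ)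

  module _ {ρ} (p : 1 ≤ n) (fr : Fresh ρ 0) (tr : Tracks ρ (initSeq n p) (initSeq n p))
           {ℓ} {U : Structure σ ℓ} {ā : Vec (Carrier U) n} where

    TreeOut-normalise : ∀ {G t} → TreeOut (treeScheme n p G) U ā t →
                        TreeOut (treeScheme n p (normalise ρ 0 G)) U ā (t ⊓ L)
    TreeOut-normalise (τ , holds , refl) =
      normalisePath ρ 0 τ , subst (All (LitHolds U ā)) (sym (conds-normalisePath fr tr τ)) holds ,
      labelOf-normalisePath ρ 0 τ

    TreeOut-unnormalise : ∀ {G t} → TreeOut (treeScheme n p (normalise ρ 0 G)) U ā t →
                          ∃ λ t₀ → TreeOut (treeScheme n p G) U ā t₀ × t ≡ t₀ ⊓ L
    TreeOut-unnormalise {G} (τ′ , holds , refl) with normalisePath-surjective ρ 0 G τ′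
    ... | τ , refl =
      labelOf τ , (τ , subst (All (LitHolds U ā)) (conds-normalisePath fr tr τ) holds , refl) ,
      labelOf-normalisePath ρ 0 τ

_≟ᴷ_ : DecidableEquality Kind
predK ≟ᴷ predK = yes refl
predK ≟ᴷ funK  = no λ ()
funK  ≟ᴷ predK = no λ ()
funK  ≟ᴷ funK  = yes refl

-- Code d encodes the trees of depth ≤ d with labels ≤ L whose expressions
-- only mention the variables x₀,…,x_{B-1}.
module Codes (σ : Signature) (L B : ℕ) where

  FunCode : Set
  FunCode = Σ (FunSym σ) λ f → Fin B × Vec (Fin B) (arity σ (proj₁ f))

  PredCode : Set
  PredCode = (Fin B × Fin B) ⊎ Σ (PredSym σ) λ r → Vec (Fin B) (arity σ (proj₁ r))

  mutual
    Code : ℕ → Set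
    Code d = Fin (suc L) ⊎ Node d

    Node : ℕ → Set
    Node zero    = ⊥
    Node (suc d) = (FunCode × Code d) ⊎ (PredCode × Code d × Code d)

  decodeF : FunCode → FunExpr σ
  decodeF (f , j , ls) = toℕ j ⇐ f ⟨ Vec.map toℕ ls ⟩

  decodeP : PredCode → PredExpr σ
  decodeP (inj₁ (l₁ , l₂)) = eqE (toℕ l₁) (toℕ l₂)
  decodeP (inj₂ (r , ls))  = relE r (Vec.map toℕ ls)

  decode : ∀ d → Code d → Tree σ
  decode d       (inj₁ t)                    = leaf (toℕ t)
  decode (suc d) (inj₂ (inj₁ (e , c)))       = fnode (decodeF e) (decode d c)
  decode (suc d) (inj₂ (inj₂ (e , c₀ , c₁))) = pnode (decodeP e) (decode d c₀) (decode d c₁)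

  searchable-FunCode : Searchable FunCode
  searchable-FunCode =
    searchable-Σ (searchable-Σ (searchable-Fin (m σ)) (λ f → searchable-≡ _≟ᴷ_ (kind σ f) funK))
                 (λ f → searchable-× (searchable-Fin B) (searchable-Vec (searchable-Fin B) _))

  searchable-PredCode : Searchable PredCode
  searchable-PredCode =
    searchable-⊎ (searchable-× (searchable-Fin B) (searchable-Fin B))
                 (searchable-Σ (searchable-Σ (searchable-Fin (m σ)) (λ r → searchable-≡ _≟ᴷ_ (kind σ r) predK))
                               (λ r → searchable-Vec (searchable-Fin B) _))

  mutual
    searchable-Code : ∀ d → Searchable (Code d)
    searchable-Code d = searchable-⊎ (searchable-Fin (suc L)) (searchable-Node d)

    searchable-Node : ∀ d → Searchable (Node d)
    searchable-Node zero    = searchable-⊥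
    searchable-Node (suc d) =
      searchable-⊎ (searchable-× searchable-FunCode (searchable-Code d))
                   (searchable-× searchable-PredCode (searchable-× (searchable-Code d) (searchable-Code d)))

module Encode {σ : Signature} (n L D : ℕ) where
  open Normalise {σ} n L
  open Codes σ L (D + n)

  module _ {ρ : Renaming} (bound : ∀ i → ρ i < D + n) where

    encodeVars : ∀ {a} → Vec ℕ a → Vec (Fin (D + n)) a
    encodeVars = Vec.map (λ l → fromℕ< (bound l))

    toℕ-encodeVars : ∀ {a} (ls : Vec ℕ a) → Vec.map toℕ (encodeVars ls) ≡ Vec.map ρ ls
    toℕ-encodeVars ls = trans (sym (Vec.map-∘ toℕ _ ls)) (Vec.map-cong (λ l → toℕ-fromℕ< (bound l)) ls)

    encodeP : (e : PredExpr σ) → Σ PredCode λ c → decodeP c ≡ renameP ρ e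
    encodeP (eqE l₁ l₂) = inj₁ (fromℕ< (bound l₁) , fromℕ< (bound l₂)) ,
                          cong₂ eqE (toℕ-fromℕ< (bound l₁)) (toℕ-fromℕ< (bound l₂))
    encodeP (relE r ls) = inj₂ (r , encodeVars ls) , cong (relE r) (toℕ-encodeVars ls)

  fresh-bound : ∀ {ρ k} → k ≤ D → Fresh ρ k → ∀ i → ρ i < D + n
  fresh-bound k≤D fr i = <-≤-trans (fr i) (+-monoˡ-≤ n k≤D)

  encode : ∀ d {ρ k} → k + d ≤ D → Fresh ρ k → (G : Tree σ) → depth G ≤ d →
           Σ (Code d) λ c → decode d c ≡ normalise ρ k G
  encode d room fr (leaf t) _ = inj₁ (fromℕ< (s≤s (m⊓n≤n t L))) , cong leaf (toℕ-fromℕ< _)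
  encode (suc d) {ρ} {k} room fr (fnode (j ⇐ f ⟨ ls ⟩) G) (s≤s G≤d) =
    let c , c≡ = encode d room′ (fresh-extend fr j) G G≤d
    in inj₂ (inj₁ ((f , fromℕ< k+n<D+n , encodeVars bound ls) , c)) ,
       cong₂ fnode (cong₂ (λ v vs → v ⇐ f ⟨ vs ⟩) (toℕ-fromℕ< k+n<D+n) (toℕ-encodeVars bound ls)) c≡
    where
    room′ : suc k + d ≤ D
    room′ = ≤-trans (≤-reflexive (sym (+-suc k d))) room
    k+n<D+n : k + n < D + n
    k+n<D+n = +-monoˡ-< n (m+n≤o⇒m≤o (suc k) room′)
    bound : ∀ i → ρ i < D + n
    bound = fresh-bound (m+n≤o⇒m≤o k room) fr
  encode (suc d) {ρ} {k} room fr (pnode e G₀ G₁) (s≤s G≤d) =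
    let cₑ , cₑ≡ = encodeP (fresh-bound (m+n≤o⇒m≤o k room) fr) e
        c₀ , c₀≡ = encode d room′ fr G₀ (m⊔n≤o⇒m≤o _ _ G≤d)
        c₁ , c₁≡ = encode d room′ fr G₁ (m⊔n≤o⇒n≤o _ _ G≤d)
    in inj₂ (inj₂ (cₑ , c₀ , c₁)) , cong₂ (λ e′ (G₀′ , G₁′) → pnode e′ G₀′ G₁′) cₑ≡ (cong₂ _,_ c₀≡ c₁≡)
    where
    room′ : k + d ≤ D
    room′ = ≤-trans (+-monoʳ-≤ k (n≤1+n d)) room

module ProblemTree {σ : Signature} where

  problemTree : (βs : List (Expr σ)) → (Vec Bool (npred βs) → ℕ) → Tree σ
  problemTree []            ν = leaf (ν [])
  problemTree (inj₁ e ∷ βs) ν = fnode e (problemTree βs ν)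
  problemTree (inj₂ e ∷ βs) ν = pnode e (problemTree βs (ν ∘ (false ∷_))) (problemTree βs (ν ∘ (true ∷_)))

  module _ {ℓ} (U : Structure σ ℓ) {n} (ā : Vec (Carrier U) n) where

    Realises : TermSeq σ n → (βs : List (Expr σ)) → Vec Bool (npred βs) → Set ℓ
    Realises M βs b = (j : Fin (npred βs)) → HoldsLit U ā (lookup (atomsOf M βs) j) (lookup b j)

    realises-∷ : ∀ {M e βs c b} → HoldsLit U ā (κ M e) c → Realises M βs b → Realises M (inj₂ e ∷ βs) (c ∷ b)
    realises-∷ h hs Fin.zero    = h
    realises-∷ h hs (Fin.suc j) = hs j

    problemTree-sound : ∀ M βs ν (τ : Path (problemTree βs ν)) → All (LitHolds U ā) (conds M τ) →
                        ∃ λ b → Realises M βs b × ν b ≡ labelOf τ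
    problemTree-sound M []            ν (end _)  []          = [] , (λ ()) , refl
    problemTree-sound M (inj₁ e ∷ βs) ν (viaF τ) hs          = problemTree-sound (applyF M e) βs ν τ hs
    problemTree-sound M (inj₂ e ∷ βs) ν (via0 τ) (h ∷ hs)    =
      let b , real , eq = problemTree-sound M βs _ τ hs in false ∷ b , realises-∷ {βs = βs} h real , eq
    problemTree-sound M (inj₂ e ∷ βs) ν (via1 τ) (h ∷ hs)    =
      let b , real , eq = problemTree-sound M βs _ τ hs in true ∷ b , realises-∷ {βs = βs} h real , eq

    problemTree-complete : ∀ M βs ν b → Realises M βs b →
                           ∃ λ (τ : Path (problemTree βs ν)) → All (LitHolds U ā) (conds M τ) × labelOf τ ≡ ν b
    problemTree-complete M []            ν []          real = end _ , [] , refl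
    problemTree-complete M (inj₁ e ∷ βs) ν b           real =
      let τ , hs , eq = problemTree-complete (applyF M e) βs ν b real in viaF τ , hs , eq
    problemTree-complete M (inj₂ e ∷ βs) ν (false ∷ b) real =
      let τ , hs , eq = problemTree-complete M βs _ b (real ∘ Fin.suc) in via0 τ , real Fin.zero ∷ hs , eq
    problemTree-complete M (inj₂ e ∷ βs) ν (true ∷ b)  real =
      let τ , hs , eq = problemTree-complete M βs _ b (real ∘ Fin.suc) in via1 τ , real Fin.zero ∷ hs , eq

clamp-idem : ∀ k i → clamp k (toℕ (clamp k i)) ≡ clamp k i
clamp-idem k       zero    = refl
clamp-idem zero    (suc i) = refl
clamp-idem (suc k) (suc i) = cong Fin.suc (clamp-idem k i)

initialRenaming : ℕ → ℕ → ℕ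
initialRenaming n i = toℕ (clamp (pred n) i)

initialRenaming-< : ∀ n → 1 ≤ n → ∀ i → initialRenaming n i < n
initialRenaming-< (suc k) _ i = toℕ<n (clamp k i)

initSeq-initialRenaming : ∀ {σ} n (p : 1 ≤ n) i → initSeq {σ} n p (initialRenaming n i) ≡ initSeq n p i
initSeq-initialRenaming (suc k) _ i = cong var (clamp-idem k i)

maxOverBits : ∀ k → (Vec Bool k → ℕ) → ℕ
maxOverBits zero    f = f []
maxOverBits (suc k) f = maxOverBits k (f ∘ (false ∷_)) ⊔ maxOverBits k (f ∘ (true ∷_))

≤-maxOverBits : ∀ k f (b : Vec Bool k) → f b ≤ maxOverBits k f
≤-maxOverBits zero    f []          = ≤-refl
≤-maxOverBits (suc k) f (false ∷ b) = ≤-trans (≤-maxOverBits k _ b) (m≤m⊔n _ _)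
≤-maxOverBits (suc k) f (true ∷ b)  = ≤-trans (≤-maxOverBits k _ b) (m≤n⊔m _ _)

module Optimisation {σ ℓ c} (ψ : Word σ → ℕ) (strict : StrictlyLimited {σ} ψ)
                    (s : ProblScheme σ) (R : Structure σ ℓ → Set c) where
  open ProblScheme s using (β; ν) renaming (n to n₀; n≥1 to n₀≥1)
  open ProblemTree

  scheme : Tree σ → TreeScheme σ
  scheme = treeScheme n₀ n₀≥1

  Computes : Tree σ → Set (lsuc ℓ ⊔ℓ c)
  Computes G = ∀ U → R U → ∀ ā t →
    (TreeOut (scheme G) U ā t → ProblOut s U ā t) × (ProblOut s U ā t → TreeOut (scheme G) U ā t)

  computes⇒solves : ∀ {G} → Computes G → Solves (scheme G) s R
  computes⇒solves h = refl , h

  solves⇒computes : ∀ {S} → Solves S s R → Computes (G S)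
  solves⇒computes {treeScheme _ p _} (refl , h) with ≤-irrelevant p n₀≥1
  ... | refl = h

  problemTree-computes : Computes (problemTree β ν)
  problemTree-computes U _ ā t =
    (λ (τ , holds , τ↦t) → let b , real , νb≡ = problemTree-sound U ā (initSeq n₀ n₀≥1) β ν τ holds
                           in b , real , trans νb≡ τ↦t) ,
    (λ (b , real , νb≡t) → let τ , holds , τ↦ = problemTree-complete U ā (initSeq n₀ n₀≥1) β ν b real
                           in τ , holds , trans τ↦ νb≡t)

  L : ℕ
  L = maxOverBits _ ν

  ProblOut-≤ : ∀ {ℓ′} {U : Structure σ ℓ′} {ā t} → ProblOut s U ā t → t ≤ L
  ProblOut-≤ (b , _ , refl) = ≤-maxOverBits _ ν b

  open Normalise {σ} n₀ L

  ρ₀ : Renaming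
  ρ₀ = initialRenaming n₀

  fresh₀ : Fresh ρ₀ 0
  fresh₀ = initialRenaming-< n₀ n₀≥1

  tracks₀ : Tracks ρ₀ (initSeq n₀ n₀≥1) (initSeq n₀ n₀≥1)
  tracks₀ = initSeq-initialRenaming n₀ n₀≥1

  -- Clipping at L is harmless: a solution only ever outputs values of ν.
  computes-normalise : ∀ {G} → Computes G → Computes (normalise ρ₀ 0 G)
  computes-normalise {G} h U u ā t = to , from
    where
    to : TreeOut (scheme (normalise ρ₀ 0 G)) U ā t → ProblOut s U ā t
    to out with TreeOut-unnormalise n₀≥1 fresh₀ tracks₀ out
    ... | t₀ , out₀ , refl =
      let sol = proj₁ (h U u ā t₀) out₀ in subst (ProblOut s U ā) (sym (m≤n⇒m⊓n≡m (ProblOut-≤ sol))) sol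
    from : ProblOut s U ā t → TreeOut (scheme (normalise ρ₀ 0 G)) U ā t
    from sol = subst (TreeOut (scheme (normalise ρ₀ 0 G)) U ā) (m≤n⇒m⊓n≡m (ProblOut-≤ sol))
                     (TreeOut-normalise n₀≥1 fresh₀ tracks₀ (proj₂ (h U u ā t) sol))

  D : ℕ
  D = ψTree ψ (scheme (problemTree β ν))

  open Codes σ L (D + n₀)
  open Encode {σ} n₀ L D

  candidate : Code D → TreeScheme σ
  candidate c = scheme (decode D c)

  representable : ∀ {S} → Solves S s R → ψTree ψ S ≤ D →
                  ∃ λ c → Solves (candidate c) s R × ψTree ψ (candidate c) ≡ ψTree ψ S
  representable {S} sol ψS≤D =
    let c , c≡ = encode D ≤-refl fresh₀ (G S) (≤-trans (depth≤ψTree ψ strict S) ψS≤D)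
    in c , subst (λ G → Solves (scheme G) s R) (sym c≡) (computes⇒solves (computes-normalise (solves⇒computes sol))) ,
       trans (cong (ψTree ψ ∘ scheme) c≡) (ψTree-normalise ψ ρ₀ 0 n₀≥1 (G S))

  optimal : ((S : TreeScheme σ) → Dec (Solves S s R)) →
            Σ (TreeScheme σ) λ S → Solves S s R × (∀ S′ → Solves S′ s R → ψTree ψ S ≤ ψTree ψ S′)
  optimal solves? with representable (computes⇒solves problemTree-computes) ≤-refl
  ... | c₀ , sol₀ , ψc₀≡D with argmin (searchable-Code D) (solves? ∘ candidate) (ψTree ψ ∘ candidate) (c₀ , sol₀)
  ...   | c , sol , minimal = candidate c , sol , optimality
    where
    optimality : ∀ S′ → Solves S′ s R → ψTree ψ (candidate c) ≤ ψTree ψ S′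
    optimality S′ sol′ with ≤-total (ψTree ψ S′) D
    ... | inj₁ ψS′≤D = let c′ , sol″ , ψc′≡ = representable sol′ ψS′≤D in ≤-trans (minimal c′ sol″) (≤-reflexive ψc′≡)
    ... | inj₂ D≤ψS′ = ≤-trans (minimal c₀ sol₀) (≤-trans (≤-reflexive ψc₀≡D) D≤ψS′)

corollary2 : ∀ {ℓ c h : Level} (σ : Signature) (ψ : Word σ → ℕ) → StrictlyLimited {σ} ψ →
    (C : Structure σ ℓ → Set c) → Σ (Structure σ ℓ) C →
    (H : Sentence σ → Set h) → Σ (Sentence σ) H →
    SolvabilityDecidable H C → EOptimizationDecidable ψ H C
corollary2 σ ψ strict C _ H _ solvable? α hα s = Optimisation.optimal ψ strict s (Restrict C α) (solvable? α hα s)
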